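{- Let $k$ and $i$ be integers with $1\le i\le k/2$ and $k\equiv i\equiv 0\pmod 3$. Then for all integers $n\ge 0$, $$S_{k,i}(3n+2)\equiv 0\pmod 4.$$
   Context: Write $(a;q)_\infty=\prod_{m\ge 0}(1-aq^m)$, $(a)_\infty=(a;q)_\infty$, and $(a_1,\ldots,a_r;q)_\infty=(a_1;q)_\infty\cdots(a_r;q)_\infty$. For integers $k,i$ with $1\le i\le k/2$, the integers $S_{k,i}(n)$, $n\ge 0$, are given by the generating function $$\sum_{n\ge 0}S_{k,i}(n)q^n=\frac{(-q)_\infty\,(q^i,q^{k-i},q^k;q^k)_\infty}{(q)_\infty}.$$ Combinatorially (an overpartition of $n$ is a partition of $n$ in which the first occurrence of each integer may be overlined): if $i<k/2$, $S_{k,i}(n)$ is the number of overpartitions of $n$ whose non-overlined parts are not congruent to $0,\pm i$ modulo $k$; if $i=k/2$, it is the number of overpartitions of $n$ with no part divisible by $k/2$. -}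

module Defs where

import Algebra.Properties.Semiring.Sum
open import Data.Bool.Base using (if_then_else_)
open import Data.Fin.Base using (Fin; zero; suc; toℕ)
open import Data.Integer.Base using (ℤ; _+_; _-_; _*_; -_; 0ℤ; 1ℤ)
open import Data.Integer.Properties using (+-*-semiring; *-zeroʳ;
  *-identityˡ; *-identityʳ; +-identityˡ; +-identityʳ; +-inverseˡ)
open import Data.Nat.Base as ℕ using (ℕ; zero; suc; _∸_; _≡ᵇ_; _≤_; _<_; s≤s;
  NonZero; _≤′_; ≤′-refl; ≤′-step)
import Data.Nat.Properties as ℕₚ
open import Data.Vec.Base using (Vec; []; _∷_; head; lookup)
open import Relation.Binary.PropositionalEquality
  using (_≡_; _≗_; refl; sym; trans; cong; cong₂; module ≡-Reasoning)

open Algebra.Properties.Semiring.Sum +-*-semiring public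
  using (sum; sum-syntax; sum-cong-≗; sum-replicate-zero)

-- Formal power series in q over ℤ: f n is the coefficient of qⁿ.
Series : Set
Series = ℕ → ℤ

infixl 7 _⊛_ _⊘_
infixl 6 _⊖_
infix 8 ⊝_
infix 9 q^_

𝟙 : Series
𝟙 zero    = 1ℤ
𝟙 (suc _) = 0ℤ

q^_ : ℕ → Series
(q^ e) n = if e ≡ᵇ n then 1ℤ else 0ℤ

⊝_ : Series → Series
(⊝ f) n = - f n

_⊖_ : Series → Series → Series
(f ⊖ g) n = f n - g n

_⊛_ : Series → Series → Series
(f ⊛ g) n = ∑[ i < suc n ] (f (toℕ i) * g (n ∸ toℕ i))

-- recips f n lists the coefficients n, n-1, …, 0 of 1/f, for f with constant
-- term 1 (see ⊛-recip); for other f the value is meaningless.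
recips : Series → (n : ℕ) → Vec ℤ (suc n)
recips f zero    = 1ℤ ∷ []
recips f (suc n) =
  (- (∑[ j < suc n ] (f (suc (toℕ j)) * lookup (recips f n) j))) ∷ recips f n

recip : Series → Series
recip f n = head (recips f n)

_⊘_ : Series → Series → Series
f ⊘ g = f ⊛ recip g

-- ∏_{m<N} (1 - a q^{km})
partialPoch : Series → ℕ → ℕ → Series
partialPoch a k zero    = 𝟙
partialPoch a k (suc m) = partialPoch a k m ⊛ (𝟙 ⊖ a ⊛ q^ (k ℕ.* m))

-- (a ; q^k)_∞ for k ≥ 1. The factors with m > n do not affect the coefficient
-- of qⁿ, so it can be read off from the first n + 1 factors (see poch-stable).
⦅_⨾q^_⦆∞ : Series → ℕ → Series
⦅ a ⨾q^ k ⦆∞ n = partialPoch a k (suc n) n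

⦅_⦆∞ : Series → Series
⦅ a ⦆∞ = ⦅ a ⨾q^ 1 ⦆∞

-- The truncated k ∸ i is the integer k - i in the range 1 ≤ i ≤ k/2 of interest.
S : ℕ → ℕ → Series
S k i =
  (⦅ ⊝ q^ 1 ⦆∞ ⊛ (⦅ q^ i ⨾q^ k ⦆∞ ⊛ ⦅ q^ (k ∸ i) ⨾q^ k ⦆∞ ⊛ ⦅ q^ k ⨾q^ k ⦆∞))
  ⊘ ⦅ q^ 1 ⦆∞

lookup-recips : ∀ f n (j : Fin (suc n)) → lookup (recips f n) j ≡ recip f (n ∸ toℕ j)
lookup-recips f zero    zero    = refl
lookup-recips f (suc n) zero    = refl
lookup-recips f (suc n) (suc j) = lookup-recips f n j

⊛-recip : ∀ f → f 0 ≡ 1ℤ → f ⊛ recip f ≗ 𝟙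
⊛-recip f f0 zero    rewrite f0 = refl
⊛-recip f f0 (suc n) = begin
  f 0 * - s + t    ≡⟨ cong₂ (λ x y → x * - s + y) f0 t≡s ⟩
  1ℤ * - s + s     ≡⟨ cong (_+ s) (*-identityˡ (- s)) ⟩
  - s + s          ≡⟨ +-inverseˡ s ⟩
  0ℤ               ∎
  where
  open ≡-Reasoning
  s = ∑[ j < suc n ] (f (suc (toℕ j)) * lookup (recips f n) j)
  t = ∑[ j < suc n ] (f (suc (toℕ j)) * recip f (n ∸ toℕ j))
  t≡s : t ≡ s
  t≡s = sum-cong-≗ {suc n} λ j → cong (f (suc (toℕ j)) *_) (sym (lookup-recips f n j))

poch-q-0 : ⦅ q^ 1 ⦆∞ 0 ≡ 1ℤ
poch-q-0 = refl

sum-zero : ∀ n (t : Fin n → ℤ) → (∀ i → t i ≡ 0ℤ) → sum t ≡ 0ℤ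
sum-zero n t t≡0 = trans (sum-cong-≗ {n} t≡0) (sum-replicate-zero n)

q^-below : ∀ e n → n < e → (q^ e) n ≡ 0ℤ
q^-below (suc e) zero    _         = refl
q^-below (suc e) (suc n) (s≤s n<e) = q^-below e n n<e

⊛-q^-below : ∀ a e n → n < e → (a ⊛ q^ e) n ≡ 0ℤ
⊛-q^-below a e n n<e = sum-zero (suc n) _ λ i →
  trans (cong (a (toℕ i) *_) (q^-below e (n ∸ toℕ i) (ℕₚ.≤-<-trans (ℕₚ.m∸n≤m n (toℕ i)) n<e)))
        (*-zeroʳ (a (toℕ i)))

⊛-cong-≤ : ∀ f g h n → (∀ m → m ≤ n → g m ≡ h m) → (f ⊛ g) n ≡ (f ⊛ h) n
⊛-cong-≤ f g h n eq = sum-cong-≗ {suc n} λ i →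
  cong (f (toℕ i) *_) (eq (n ∸ toℕ i) (ℕₚ.m∸n≤m n (toℕ i)))

⊛-identityʳ : ∀ f → f ⊛ 𝟙 ≗ f
⊛-identityʳ f zero    = trans (+-identityʳ (f 0 * 1ℤ)) (*-identityʳ (f 0))
⊛-identityʳ f (suc n) = begin
  f 0 * 0ℤ + ((λ m → f (suc m)) ⊛ 𝟙) n  ≡⟨ cong₂ _+_ (*-zeroʳ (f 0)) (⊛-identityʳ (λ m → f (suc m)) n) ⟩
  0ℤ + f (suc n)                        ≡⟨ +-identityˡ (f (suc n)) ⟩
  f (suc n)                             ∎
  where open ≡-Reasoning

partialPoch-step : ∀ a k .{{_ : NonZero k}} n m → n < m →
                   partialPoch a k (suc m) n ≡ partialPoch a k m n
partialPoch-step a k n m n<m =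
  trans (⊛-cong-≤ (partialPoch a k m) _ 𝟙 n λ j j≤n →
          trans (cong (λ x → 𝟙 j - x) (⊛-q^-below a (k ℕ.* m) j
                  (ℕₚ.<-≤-trans (ℕₚ.≤-<-trans j≤n n<m) (ℕₚ.m≤n*m m k))))
                (+-identityʳ (𝟙 j)))
        (⊛-identityʳ (partialPoch a k m) n)

poch-stable : ∀ a k .{{_ : NonZero k}} n N → n < N →
              partialPoch a k N n ≡ ⦅ a ⨾q^ k ⦆∞ n
poch-stable a k n N n<N = go (ℕₚ.≤⇒≤′ n<N)
  where
  go : ∀ {N} → suc n ≤′ N → partialPoch a k N n ≡ ⦅ a ⨾q^ k ⦆∞ n
  go ≤′-refl         = refl
  go (≤′-step {m} p) = trans (partialPoch-step a k n m (ℕₚ.≤′⇒≤ p)) (go p)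

{-# OPTIONS --safe #-}

-- Modulo 4, (-q)_∞/(q)_∞ = ∏ₘ (1 + 2 qᵐ/(1 - qᵐ)) ≡ 1 + 2 ∑ₘ qᵐ/(1 - qᵐ)
-- = 1 + 2 ∑_{a,b ≥ 1} q^{ab}. Pairing (a,b) with (b,a) leaves 1 + 2 ∑_{a ≥ 1} q^{a²}
-- modulo 4, whose exponents are never ≡ 2 (mod 3). The remaining factor of the
-- generating function is a series in q³, so it cannot create such exponents.
-- All infinite sums and products are handled in (ℤ/4)[q]/(q^N).

module Submission where

open import Defs
open import Data.Nat.Base using (ℕ; _+_; _*_; _≤_)
open import Data.Nat.Divisibility using (_∣_)
open import Data.Integer.Base using (+_)
import Data.Integer.Divisibility as ℤ

open import Algebra.Bundles using (CommutativeSemiring)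
import Algebra.Solver.Ring.NaturalCoefficients.Default as SemiringSolver
import Algebra.Structures.Biased as Biased
open import Data.Bool.Base using (true; false; T)
open import Data.Fin.Base using (Fin; zero; suc; toℕ)
open import Data.Fin.Properties using (toℕ≤pred[n])
open import Data.Integer.Base as ℤ using (ℤ; 0ℤ; 1ℤ)
import Data.Integer.Divisibility.Signed as Signed
import Data.Integer.Properties as ℤₚ
import Data.Integer.Tactic.RingSolver as ℤ-Solver
open import Data.Nat.Base using (zero; suc; _∸_; _<_; _≡ᵇ_)
open import Data.Nat.Divisibility using (divides; _∣?_; ∣m∣n⇒∣m+n; ∣m+n∣m⇒∣n; ∣m⇒∣m*n; m∣m*n)
import Data.Nat.Properties as ℕₚ
import Data.Nat.Tactic.RingSolver as ℕ-Solver
open import Data.Product.Base using (∃; _,_)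
open import Level using (0ℓ)
open import Relation.Binary.Structures using (IsEquivalence)
open import Relation.Binary.PropositionalEquality
  using (_≡_; _≗_; refl; sym; trans; cong; cong₂; subst; module ≡-Reasoning)
open import Relation.Nullary using (¬_; yes; no; contradiction)
open import Relation.Nullary.Decidable using (from-no; ¬?)
open import Relation.Unary using (Pred; Decidable)

-- The ring of power series

infixl 6 _⊕_

_⊕_ : Series → Series → Series
(f ⊕ g) n = f n ℤ.+ g n

𝟘 : Series
𝟘 _ = 0ℤ

-- By definition `(f ⊛ g) (suc n)` unfolds to `f 0 * g (suc n) + (tail f ⊛ g) n`, so the ring laws
-- go by induction on the coefficient with `f` replaced by `tail f`.
tail : Series → Series
tail f n = f (suc n)

scale : ℤ → Series → Series
scale c f n = c ℤ.* f n

⊛-congˡ : ∀ f {g h} → g ≗ h → f ⊛ g ≗ f ⊛ h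
⊛-congˡ f {g} {h} g≗h n = ⊛-cong-≤ f g h n λ m _ → g≗h m

⊛-distribʳ-⊕ : ∀ h f g → (f ⊕ g) ⊛ h ≗ f ⊛ h ⊕ g ⊛ h
⊛-distribʳ-⊕ h f g zero    = identity (f 0) (g 0) (h 0)
  where
  identity : ∀ a b c → (a ℤ.+ b) ℤ.* c ℤ.+ 0ℤ ≡ a ℤ.* c ℤ.+ 0ℤ ℤ.+ (b ℤ.* c ℤ.+ 0ℤ)
  identity = ℤ-Solver.solve-∀
⊛-distribʳ-⊕ h f g (suc n) =
  trans (cong (ℤ._+_ ((f 0 ℤ.+ g 0) ℤ.* h (suc n))) (⊛-distribʳ-⊕ h (tail f) (tail g) n))
        (identity (f 0) (g 0) (h (suc n)) ((tail f ⊛ h) n) ((tail g ⊛ h) n))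
  where
  identity : ∀ a b c x y → (a ℤ.+ b) ℤ.* c ℤ.+ (x ℤ.+ y) ≡ a ℤ.* c ℤ.+ x ℤ.+ (b ℤ.* c ℤ.+ y)
  identity = ℤ-Solver.solve-∀

⊛-scaleˡ : ∀ c f g → scale c f ⊛ g ≗ scale c (f ⊛ g)
⊛-scaleˡ c f g zero    = identity c (f 0) (g 0)
  where
  identity : ∀ c a b → c ℤ.* a ℤ.* b ℤ.+ 0ℤ ≡ c ℤ.* (a ℤ.* b ℤ.+ 0ℤ)
  identity = ℤ-Solver.solve-∀
⊛-scaleˡ c f g (suc n) =
  trans (cong (ℤ._+_ (c ℤ.* f 0 ℤ.* g (suc n))) (⊛-scaleˡ c (tail f) g n)) (identity c (f 0) (g (suc n)) ((tail f ⊛ g) n))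
  where
  identity : ∀ c a b x → c ℤ.* a ℤ.* b ℤ.+ c ℤ.* x ≡ c ℤ.* (a ℤ.* b ℤ.+ x)
  identity = ℤ-Solver.solve-∀

-- The mirror image of the definitional unfolding: the last term of the convolution is split off
-- instead of the first. Comparing the two unfoldings gives commutativity.
⊛-suc : ∀ f g n → (f ⊛ g) (suc n) ≡ f (suc n) ℤ.* g 0 ℤ.+ (f ⊛ tail g) n
⊛-suc f g zero    = identity (f 0) (f 1) (g 0) (g 1)
  where
  identity : ∀ a b c d → a ℤ.* d ℤ.+ (b ℤ.* c ℤ.+ 0ℤ) ≡ b ℤ.* c ℤ.+ (a ℤ.* d ℤ.+ 0ℤ)
  identity = ℤ-Solver.solve-∀
⊛-suc f g (suc n) =
  trans (cong (ℤ._+_ (f 0 ℤ.* g (suc (suc n)))) (⊛-suc (tail f) g n))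
        (identity (f 0 ℤ.* g (suc (suc n))) (f (suc (suc n)) ℤ.* g 0) ((tail f ⊛ tail g) n))
  where
  identity : ∀ a b x → a ℤ.+ (b ℤ.+ x) ≡ b ℤ.+ (a ℤ.+ x)
  identity = ℤ-Solver.solve-∀

⊛-comm : ∀ f g → f ⊛ g ≗ g ⊛ f
⊛-comm f g zero    = cong (ℤ._+ 0ℤ) (ℤₚ.*-comm (f 0) (g 0))
⊛-comm f g (suc n) =
  trans (cong₂ ℤ._+_ (ℤₚ.*-comm (f 0) (g (suc n))) (⊛-comm (tail f) g n)) (sym (⊛-suc g f n))

⊛-assoc : ∀ f g h → (f ⊛ g) ⊛ h ≗ f ⊛ (g ⊛ h)
⊛-assoc f g h zero    = identity (f 0) (g 0) (h 0)
  where
  identity : ∀ a b c → (a ℤ.* b ℤ.+ 0ℤ) ℤ.* c ℤ.+ 0ℤ ≡ a ℤ.* (b ℤ.* c ℤ.+ 0ℤ) ℤ.+ 0ℤ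
  identity = ℤ-Solver.solve-∀
⊛-assoc f g h (suc n) = begin
  -- The series `tail (f ⊛ g)` is `scale (f 0) (tail g) ⊕ tail f ⊛ g` by definition.
  z ℤ.+ ((scale (f 0) (tail g) ⊕ tail f ⊛ g) ⊛ h) n
    ≡⟨ cong (ℤ._+_ z) (⊛-distribʳ-⊕ h (scale (f 0) (tail g)) (tail f ⊛ g) n) ⟩
  z ℤ.+ ((scale (f 0) (tail g) ⊛ h) n ℤ.+ ((tail f ⊛ g) ⊛ h) n)
    ≡⟨ cong (ℤ._+_ z) (cong₂ ℤ._+_ (⊛-scaleˡ (f 0) (tail g) h n) (⊛-assoc (tail f) g h n)) ⟩
  z ℤ.+ (f 0 ℤ.* (tail g ⊛ h) n ℤ.+ (tail f ⊛ (g ⊛ h)) n)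
    ≡⟨ identity (f 0) (g 0) (h (suc n)) ((tail g ⊛ h) n) ((tail f ⊛ (g ⊛ h)) n) ⟩
  f 0 ℤ.* (g 0 ℤ.* h (suc n) ℤ.+ (tail g ⊛ h) n) ℤ.+ (tail f ⊛ (g ⊛ h)) n ∎
  where
  open ≡-Reasoning
  z = (f 0 ℤ.* g 0 ℤ.+ 0ℤ) ℤ.* h (suc n)
  identity : ∀ a b c x y →
    (a ℤ.* b ℤ.+ 0ℤ) ℤ.* c ℤ.+ (a ℤ.* x ℤ.+ y) ≡ a ℤ.* (b ℤ.* c ℤ.+ x) ℤ.+ y
  identity = ℤ-Solver.solve-∀

⊛-zeroˡ : ∀ f → 𝟘 ⊛ f ≗ 𝟘
⊛-zeroˡ f n = sum-zero (suc n) _ λ _ → refl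

⊛-identityˡ : ∀ f → 𝟙 ⊛ f ≗ f
⊛-identityˡ f n = trans (⊛-comm 𝟙 f n) (⊛-identityʳ f n)

-- Monomials and the factors of the products.

q^0 : q^ 0 ≗ 𝟙
q^0 zero    = refl
q^0 (suc _) = refl

q^-⊛ : ∀ a b → q^ a ⊛ q^ b ≗ q^ (a + b)
q^-⊛ zero    b n       = begin
  (q^ 0 ⊛ q^ b) n  ≡⟨ ⊛-comm (q^ 0) (q^ b) n ⟩
  (q^ b ⊛ q^ 0) n  ≡⟨ ⊛-congˡ (q^ b) q^0 n ⟩
  (q^ b ⊛ 𝟙) n     ≡⟨ ⊛-identityʳ (q^ b) n ⟩
  (q^ b) n         ∎
  where open ≡-Reasoning
q^-⊛ (suc a) b zero    = refl
-- The constant term of `q^ suc a` is 0 and its tail is `q^ a`.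
q^-⊛ (suc a) b (suc n) = trans (ℤₚ.+-identityˡ ((q^ a ⊛ q^ b) n)) (q^-⊛ a b n)

⊝-⊛ : ∀ f g → (⊝ f) ⊛ g ≗ ⊝ (f ⊛ g)
⊝-⊛ f g n = begin
  ((⊝ f) ⊛ g) n           ≡⟨ ⊛-comm (⊝ f) g n ⟩
  (g ⊛ (⊝ f)) n           ≡⟨ ⊛-congˡ g (λ m → sym (ℤₚ.-1*i≡-i (f m))) n ⟩
  (g ⊛ scale ℤ.-1ℤ f) n   ≡⟨ ⊛-comm g (scale ℤ.-1ℤ f) n ⟩
  (scale ℤ.-1ℤ f ⊛ g) n   ≡⟨ ⊛-scaleˡ ℤ.-1ℤ f g n ⟩
  ℤ.-1ℤ ℤ.* (f ⊛ g) n     ≡⟨ ℤₚ.-1*i≡-i ((f ⊛ g) n) ⟩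
  ℤ.- (f ⊛ g) n           ∎
  where open ≡-Reasoning

-- The exponent `1 * m` is the `k * m` of `partialPoch` at `k = 1`.
q⊛q^ : ∀ m → q^ 1 ⊛ q^ (1 * m) ≗ q^ suc m
q⊛q^ m n = trans (q^-⊛ 1 (1 * m) n) (cong (λ j → (q^ suc j) n) (ℕₚ.*-identityˡ m))

-[-q⊛q^] : ∀ m n → ℤ.- (((⊝ q^ 1) ⊛ q^ (1 * m)) n) ≡ (q^ suc m) n
-[-q⊛q^] m n = begin
  ℤ.- (((⊝ q^ 1) ⊛ q^ (1 * m)) n)      ≡⟨ cong ℤ.-_ (⊝-⊛ (q^ 1) (q^ (1 * m)) n) ⟩
  ℤ.- (ℤ.- ((q^ 1 ⊛ q^ (1 * m)) n))    ≡⟨ ℤₚ.neg-involutive _ ⟩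
  (q^ 1 ⊛ q^ (1 * m)) n                ≡⟨ q⊛q^ m n ⟩
  (q^ suc m) n                         ∎
  where open ≡-Reasoning

-- Supports of power series

Supported : Pred ℕ 0ℓ → Series → Set
Supported P f = ∀ n → ¬ P n → f n ≡ 0ℤ

-- A term `f a * g b` with `a + b = n` can be nonzero only if `P a` and `Q b`, which forces `R n`.
-- Decidability allows the case split on each term.
⊛-supported : ∀ {P Q R : Pred ℕ 0ℓ} {f g} → Decidable P → Decidable Q →
              (∀ {a b} → P a → Q b → R (a + b)) →
              Supported P f → Supported Q g → Supported R (f ⊛ g)
⊛-supported {P} {Q} {R} {f} {g} P? Q? P+Q⊆R f-supp g-supp n ¬Rn = sum-zero (suc n) _ term
  where
  term : (j : Fin (suc n)) → f (toℕ j) ℤ.* g (n ∸ toℕ j) ≡ 0ℤ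
  term j with P? (toℕ j) | Q? (n ∸ toℕ j)
  ... | no ¬p | _     = cong (ℤ._* g (n ∸ toℕ j)) (f-supp (toℕ j) ¬p)
  ... | yes _ | no ¬q = trans (cong (f (toℕ j) ℤ.*_) (g-supp (n ∸ toℕ j) ¬q)) (ℤₚ.*-zeroʳ (f (toℕ j)))
  ... | yes p | yes q =
    contradiction (subst R (ℕₚ.m+[n∸m]≡n (toℕ≤pred[n] j)) (P+Q⊆R p q)) ¬Rn

⊕-supported : ∀ {P f g} → Supported P f → Supported P g → Supported P (f ⊕ g)
⊕-supported f-supp g-supp n ¬Pn = cong₂ ℤ._+_ (f-supp n ¬Pn) (g-supp n ¬Pn)

q^-supported : ∀ {P : Pred ℕ 0ℓ} {e} → P e → Supported P (q^ e)
q^-supported {P} {e} Pe n ¬Pn with e ≡ᵇ n in eq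
... | false = refl
... | true  = contradiction (subst P (ℕₚ.≡ᵇ⇒≡ e n (subst T (sym eq) _)) Pe) ¬Pn

𝟙-supported : ∀ {P : Pred ℕ 0ℓ} → P 0 → Supported P 𝟙
𝟙-supported P0 zero    ¬P0 = contradiction P0 ¬P0
𝟙-supported P0 (suc n) _   = refl

module _ {d : ℕ} where

  ⊛-∣-supported : ∀ {f g} → Supported (d ∣_) f → Supported (d ∣_) g → Supported (d ∣_) (f ⊛ g)
  ⊛-∣-supported = ⊛-supported (d ∣?_) (d ∣?_) ∣m∣n⇒∣m+n

  -- Each factor is 1 - q^(e + km), whose exponents are multiples of `d`; such series are closed
  -- under products.
  partialPoch-∣-supported : ∀ {e k} → d ∣ e → d ∣ k → ∀ m → Supported (d ∣_) (partialPoch (q^ e) k m)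
  partialPoch-∣-supported d∣e d∣k zero    = 𝟙-supported {d ∣_} (divides 0 refl)
  partialPoch-∣-supported {e} {k} d∣e d∣k (suc m) =
    ⊛-∣-supported (partialPoch-∣-supported d∣e d∣k m) λ n d∤n →
      cong₂ ℤ._-_ (𝟙-supported {d ∣_} (divides 0 refl) n d∤n)
                  (⊛-∣-supported (q^-supported d∣e) (q^-supported (∣m⇒∣m*n m d∣k)) n d∤n)

  poch-∣-supported : ∀ {e k} → d ∣ e → d ∣ k → Supported (d ∣_) ⦅ q^ e ⨾q^ k ⦆∞
  poch-∣-supported d∣e d∣k n = partialPoch-∣-supported d∣e d∣k (suc n) n

-- Sums and products in a commutative semiring

module SemiringSums (R : CommutativeSemiring 0ℓ 0ℓ) where

  open CommutativeSemiring R
    renaming (_+_ to _+ᴿ_; _*_ to _*ᴿ_; refl to ≈-refl; sym to ≈-sym; trans to ≈-trans)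
  open SemiringSolver R
  open import Relation.Binary.Reasoning.Setoid setoid

  Σ< : ℕ → (ℕ → Carrier) → Carrier
  Σ< zero    f = 0#
  Σ< (suc n) f = Σ< n f +ᴿ f n

  Π< : ℕ → (ℕ → Carrier) → Carrier
  Π< zero    f = 1#
  Π< (suc n) f = Π< n f *ᴿ f n

  Σ<-cong : ∀ {f g} → (∀ a → f a ≈ g a) → ∀ n → Σ< n f ≈ Σ< n g
  Σ<-cong f≈g zero    = ≈-refl
  Σ<-cong f≈g (suc n) = +-cong (Σ<-cong f≈g n) (f≈g n)

  Σ<-+ : ∀ f g n → Σ< n (λ a → f a +ᴿ g a) ≈ Σ< n f +ᴿ Σ< n g
  Σ<-+ f g zero    = ≈-sym (+-identityˡ 0#)
  Σ<-+ f g (suc n) = ≈-trans (+-congʳ (Σ<-+ f g n))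
    (solve 4 (λ a b c d → (a :+ b) :+ (c :+ d) := (a :+ c) :+ (b :+ d)) ≈-refl
       (Σ< n f) (Σ< n g) (f n) (g n))

  -- Entries off the diagonal pair up across it. The witness `E` is the sum strictly on one side of
  -- the diagonal.
  symmetric-sum : ∀ (M : ℕ → ℕ → Carrier) → (∀ a b → M a b ≈ M b a) → ∀ n →
    ∃ λ E → Σ< n (λ a → Σ< n (M a)) ≈ (E +ᴿ E) +ᴿ Σ< n (λ a → M a a)
  symmetric-sum M M-sym zero    = 0# , solve 0 (con 0 := con 0 :+ con 0 :+ con 0) ≈-refl
  symmetric-sum M M-sym (suc n) with symmetric-sum M M-sym n
  -- Enlarging the square adds a row and a column, equal by symmetry, and one new diagonal entry.
  ... | E , eq = E +ᴿ Σ< n (M n) , (begin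
    Σ< n (λ a → Σ< n (M a) +ᴿ M a n) +ᴿ (Σ< n (M n) +ᴿ M n n)
      ≈⟨ +-congʳ (Σ<-+ (λ a → Σ< n (M a)) (λ a → M a n) n) ⟩
    Σ< n (λ a → Σ< n (M a)) +ᴿ Σ< n (λ a → M a n) +ᴿ (Σ< n (M n) +ᴿ M n n)
      ≈⟨ +-congʳ (+-cong eq (Σ<-cong (λ a → M-sym a n) n)) ⟩
    E +ᴿ E +ᴿ Σ< n (λ a → M a a) +ᴿ Σ< n (M n) +ᴿ (Σ< n (M n) +ᴿ M n n)
      ≈⟨ solve 4 (λ e t s d → e :+ e :+ t :+ s :+ (s :+ d)
                           := (e :+ s) :+ (e :+ s) :+ (t :+ d)) ≈-refl
           E (Σ< n (λ a → M a a)) (Σ< n (M n)) (M n n) ⟩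
    (E +ᴿ Σ< n (M n)) +ᴿ (E +ᴿ Σ< n (M n)) +ᴿ (Σ< n (λ a → M a a) +ᴿ M n n) ∎)

  module _ (four≈0 : 1# +ᴿ 1# +ᴿ 1# +ᴿ 1# ≈ 0#) where

    four*≈0 : ∀ x → (1# +ᴿ 1# +ᴿ 1# +ᴿ 1#) *ᴿ x ≈ 0#
    four*≈0 x = ≈-trans (*-congʳ four≈0) (zeroˡ x)

    -- Doubling turns the off-diagonal part 2E into 4E = 0, so only the diagonal survives.
    symmetric-sum-doubled : ∀ (M : ℕ → ℕ → Carrier) → (∀ a b → M a b ≈ M b a) → ∀ n →
      Σ< n (λ a → Σ< n (M a)) +ᴿ Σ< n (λ a → Σ< n (M a)) ≈ Σ< n (λ a → M a a) +ᴿ Σ< n (λ a → M a a)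
    symmetric-sum-doubled M M-sym n with symmetric-sum M M-sym n
    ... | E , eq = begin
      Σ< n (λ a → Σ< n (M a)) +ᴿ Σ< n (λ a → Σ< n (M a))
        ≈⟨ +-cong eq eq ⟩
      E +ᴿ E +ᴿ t +ᴿ (E +ᴿ E +ᴿ t)
        ≈⟨ solve 2 (λ e t → e :+ e :+ t :+ (e :+ e :+ t)
                         := (con 1 :+ con 1 :+ con 1 :+ con 1) :* e :+ (t :+ t)) ≈-refl E t ⟩
      (1# +ᴿ 1# +ᴿ 1# +ᴿ 1#) *ᴿ E +ᴿ (t +ᴿ t)
        ≈⟨ +-congʳ (four*≈0 E) ⟩
      0# +ᴿ (t +ᴿ t)
        ≈⟨ +-identityˡ _ ⟩
      t +ᴿ t ∎
      where t = Σ< n (λ a → M a a)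

    -- Here d = 1 - x and g = x/(1 - x), so (1 + x)/(1 - x) = 1 + 2g, and products
    -- of such factors are linear in the g's because 4 = 0.
    Π<[1+x]≈[1+2Σ<g]*Π<[1-x] : ∀ {x d g : ℕ → Carrier} →
      (∀ m → d m +ᴿ x m ≈ 1#) → (∀ m → d m *ᴿ g m ≈ x m) → ∀ n →
      Π< n (λ m → 1# +ᴿ x m) ≈ (1# +ᴿ (Σ< n g +ᴿ Σ< n g)) *ᴿ Π< n d
    Π<[1+x]≈[1+2Σ<g]*Π<[1-x] _ _ zero = solve 0 (con 1 := (con 1 :+ (con 0 :+ con 0)) :* con 1) ≈-refl
    Π<[1+x]≈[1+2Σ<g]*Π<[1-x] {x} {d} {g} d+x≈1 d*g≈x (suc n) = begin
      Π< n (λ m → 1# +ᴿ x m) *ᴿ (1# +ᴿ x n)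
        ≈⟨ *-cong (Π<[1+x]≈[1+2Σ<g]*Π<[1-x] d+x≈1 d*g≈x n) (+-congʳ (≈-sym (d+x≈1 n))) ⟩
      (1# +ᴿ (G +ᴿ G)) *ᴿ D *ᴿ ((d n +ᴿ x n) +ᴿ x n)
        ≈⟨ *-congˡ (+-cong (+-congˡ (d*g≈x n)) (d*g≈x n)) ⟨
      (1# +ᴿ (G +ᴿ G)) *ᴿ D *ᴿ ((d n +ᴿ d n *ᴿ g n) +ᴿ d n *ᴿ g n)
        ≈⟨ solve 4 (λ G D d g →
             (con 1 :+ (G :+ G)) :* D :* ((d :+ d :* g) :+ d :* g)
             := (con 1 :+ con 1 :+ con 1 :+ con 1) :* (G :* g :* D :* d)
                :+ (con 1 :+ ((G :+ g) :+ (G :+ g))) :* (D :* d)) ≈-refl G D (d n) (g n) ⟩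
      (1# +ᴿ 1# +ᴿ 1# +ᴿ 1#) *ᴿ (G *ᴿ g n *ᴿ D *ᴿ d n) +ᴿ (1# +ᴿ ((G +ᴿ g n) +ᴿ (G +ᴿ g n))) *ᴿ (D *ᴿ d n)
        ≈⟨ +-congʳ (four*≈0 _) ⟩
      0# +ᴿ (1# +ᴿ ((G +ᴿ g n) +ᴿ (G +ᴿ g n))) *ᴿ (D *ᴿ d n)
        ≈⟨ +-identityˡ _ ⟩
      (1# +ᴿ ((G +ᴿ g n) +ᴿ (G +ᴿ g n))) *ᴿ (D *ᴿ d n) ∎
      where
      G = Σ< n g
      D = Π< n d

-- The quotient ring (ℤ/c)[q]/(q^N)

module Truncated (c : ℤ) (N : ℕ) where

  infix 4 _≡ᶜ_ _≈_

  -- A record keeps `x` and `y` recoverable from the type, which the bare difference would not.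
  record _≡ᶜ_ (x y : ℤ) : Set where
    constructor mk
    field difference : c Signed.∣ x ℤ.- y

  reflᶜ : ∀ {x y} → x ≡ y → x ≡ᶜ y
  reflᶜ {x} refl = mk (Signed.divides 0ℤ (ℤₚ.+-inverseʳ x))

  symᶜ : ∀ {x y} → x ≡ᶜ y → y ≡ᶜ x
  symᶜ {x} {y} (mk p) = mk (subst (c Signed.∣_) (identity x y) (Signed.∣m⇒∣-m p))
    where
    identity : ∀ x y → ℤ.- (x ℤ.- y) ≡ y ℤ.- x
    identity = ℤ-Solver.solve-∀

  +-congᶜ : ∀ {x x′ y y′} → x ≡ᶜ x′ → y ≡ᶜ y′ → x ℤ.+ y ≡ᶜ x′ ℤ.+ y′
  +-congᶜ {x} {x′} {y} {y′} (mk p) (mk q) =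
    mk (subst (c Signed.∣_) (identity x x′ y y′) (Signed.∣m∣n⇒∣m+n p q))
    where
    identity : ∀ x x′ y y′ → x ℤ.- x′ ℤ.+ (y ℤ.- y′) ≡ x ℤ.+ y ℤ.- (x′ ℤ.+ y′)
    identity = ℤ-Solver.solve-∀

  transᶜ : ∀ {x y z} → x ≡ᶜ y → y ≡ᶜ z → x ≡ᶜ z
  transᶜ {x} {y} {z} (mk p) (mk q) =
    mk (subst (c Signed.∣_) (identity x y z) (Signed.∣m∣n⇒∣m+n p q))
    where
    identity : ∀ x y z → x ℤ.- y ℤ.+ (y ℤ.- z) ≡ x ℤ.- z
    identity = ℤ-Solver.solve-∀

  *-congᶜ : ∀ {x x′ y y′} → x ≡ᶜ x′ → y ≡ᶜ y′ → x ℤ.* y ≡ᶜ x′ ℤ.* y′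
  *-congᶜ {x} {x′} {y} {y′} (mk p) (mk q) =
    mk (subst (c Signed.∣_) (identity x x′ y y′)
          (Signed.∣m∣n⇒∣m+n (Signed.∣m⇒∣m*n y p) (Signed.∣n⇒∣m*n x′ q)))
    where
    identity : ∀ x x′ y y′ → (x ℤ.- x′) ℤ.* y ℤ.+ x′ ℤ.* (y ℤ.- y′) ≡ x ℤ.* y ℤ.- x′ ℤ.* y′
    identity = ℤ-Solver.solve-∀

  sum-congᶜ : ∀ n (s t : Fin n → ℤ) → (∀ j → s j ≡ᶜ t j) → sum s ≡ᶜ sum t
  sum-congᶜ zero    s t s≡t = reflᶜ refl
  sum-congᶜ (suc n) s t s≡t =
    +-congᶜ (s≡t zero) (sum-congᶜ n (λ j → s (suc j)) (λ j → t (suc j)) λ j → s≡t (suc j))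

  -- Congruence modulo the ideal generated by `c` and q^N.
  record _≈_ (f g : Series) : Set where
    constructor trunc
    field coeff : ∀ n → n < N → f n ≡ᶜ g n

  open _≈_ public

  ≗⇒≈ : ∀ {f g} → f ≗ g → f ≈ g
  ≗⇒≈ f≗g = trunc λ n _ → reflᶜ (f≗g n)

  -- Coefficient `n` of a product involves only coefficients of index at most `n`, hence below `N`.
  ⊛-cong-≈ : ∀ {f f′ g g′} → f ≈ f′ → g ≈ g′ → f ⊛ g ≈ f′ ⊛ g′
  ⊛-cong-≈ f≈f′ g≈g′ = trunc λ n n<N → sum-congᶜ (suc n) _ _ λ j →
    *-congᶜ (coeff f≈f′ (toℕ j) (ℕₚ.≤-<-trans (toℕ≤pred[n] j) n<N))
            (coeff g≈g′ (n ∸ toℕ j) (ℕₚ.≤-<-trans (ℕₚ.m∸n≤m n (toℕ j)) n<N))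

  ring : CommutativeSemiring 0ℓ 0ℓ
  ring = record
    { Carrier = Series ; _≈_ = _≈_ ; _+_ = _⊕_ ; _*_ = _⊛_ ; 0# = 𝟘 ; 1# = 𝟙
    ; isCommutativeSemiring = Biased.isCommutativeSemiringˡ record
      { +-isCommutativeMonoid = Biased.isCommutativeMonoidˡ record
        { isSemigroup = record
          { isMagma = record
            { isEquivalence = isEquivalence′
            ; ∙-cong = λ p q → trunc λ n n<N → +-congᶜ (coeff p n n<N) (coeff q n n<N)
            }
          ; assoc = λ f g h → ≗⇒≈ λ n → ℤₚ.+-assoc (f n) (g n) (h n)
          }
        ; identityˡ = λ f → ≗⇒≈ λ n → ℤₚ.+-identityˡ (f n)
        ; comm = λ f g → ≗⇒≈ λ n → ℤₚ.+-comm (f n) (g n)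
        }
      ; *-isCommutativeMonoid = Biased.isCommutativeMonoidˡ record
        { isSemigroup = record
          { isMagma = record { isEquivalence = isEquivalence′ ; ∙-cong = ⊛-cong-≈ }
          ; assoc = λ f g h → ≗⇒≈ (⊛-assoc f g h)
          }
        ; identityˡ = λ f → ≗⇒≈ (⊛-identityˡ f)
        ; comm = λ f g → ≗⇒≈ (⊛-comm f g)
        }
      ; distribʳ = λ f g h → ≗⇒≈ (⊛-distribʳ-⊕ f g h)
      ; zeroˡ = λ f → ≗⇒≈ (⊛-zeroˡ f)
      }
    }
    where
    isEquivalence′ : IsEquivalence _≈_
    isEquivalence′ = record
      { refl  = ≗⇒≈ λ _ → refl
      ; sym   = λ p → trunc λ n n<N → symᶜ (coeff p n n<N)
      ; trans = λ p q → trunc λ n n<N → transᶜ (coeff p n n<N) (coeff q n n<N)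
      }

  open SemiringSums ring public
  open CommutativeSemiring ring public using (setoid; +-cong; +-congˡ; +-congʳ; *-congˡ; *-congʳ)
    renaming (refl to ≈-refl; sym to ≈-sym; trans to ≈-trans)
  open import Relation.Binary.Reasoning.Setoid setoid

  Σ<-supported : ∀ {P : Pred ℕ 0ℓ} {f} → (∀ a → Supported P (f a)) → ∀ n → Supported P (Σ< n f)
  Σ<-supported f-supp zero    m _ = refl
  Σ<-supported f-supp (suc n) = ⊕-supported (Σ<-supported f-supp n) (f-supp n)

  -- Geometric series and q-Pochhammer products modulo q^N.

  q^-≈0 : ∀ {e} → N ≤ e → q^ e ≈ 𝟘
  q^-≈0 {e} N≤e = trunc λ n n<N → reflᶜ (q^-below e n (ℕₚ.<-≤-trans n<N N≤e))

  1-q^e+q^e : ∀ e → 𝟙 ⊖ q^ e ⊕ q^ e ≈ 𝟙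
  1-q^e+q^e e = ≗⇒≈ λ n → identity (𝟙 n) ((q^ e) n)
    where
    identity : ∀ a b → a ℤ.- b ℤ.+ b ≡ a
    identity = ℤ-Solver.solve-∀

  -- A telescoping sum, with the remainder kept on the left so that semiring laws suffice:
  -- `𝟙 ⊖ q^ e` is treated as an atom whose sum with `q^ e` is 1.
  geometric-partial : ∀ e K →
    (𝟙 ⊖ q^ e) ⊛ Σ< K (λ b → q^ (e * suc b)) ⊕ q^ (e * suc K) ≈ q^ e
  geometric-partial e zero = begin
    (𝟙 ⊖ q^ e) ⊛ 𝟘 ⊕ q^ (e * 1)  ≈⟨ solve 2 (λ d x → d :* con 0 :+ x := x) ≈-refl (𝟙 ⊖ q^ e) (q^ (e * 1)) ⟩
    q^ (e * 1)                   ≡⟨ cong q^_ (ℕₚ.*-identityʳ e) ⟩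
    q^ e                         ∎
    where open SemiringSolver ring
  geometric-partial e (suc K) = begin
    d ⊛ (s ⊕ y) ⊕ q^ (e * suc (suc K))
      ≡⟨ cong (λ j → d ⊛ (s ⊕ y) ⊕ q^ j) (ℕₚ.*-suc e (suc K)) ⟩
    d ⊛ (s ⊕ y) ⊕ q^ (e + e * suc K)
      ≈⟨ +-congˡ {d ⊛ (s ⊕ y)} (≗⇒≈ (q^-⊛ e (e * suc K))) ⟨
    d ⊛ (s ⊕ y) ⊕ q^ e ⊛ y
      ≈⟨ solve 4 (λ d s y x → d :* (s :+ y) :+ x :* y := d :* s :+ (d :+ x) :* y) ≈-refl d s y (q^ e) ⟩
    d ⊛ s ⊕ (d ⊕ q^ e) ⊛ y
      ≈⟨ +-congˡ {d ⊛ s} (≈-trans (*-congʳ {y} (1-q^e+q^e e)) (≗⇒≈ (⊛-identityˡ y))) ⟩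
    d ⊛ s ⊕ y
      ≈⟨ geometric-partial e K ⟩
    q^ e ∎
    where
    open SemiringSolver ring
    d = 𝟙 ⊖ q^ e
    s = Σ< K (λ b → q^ (e * suc b))
    y = q^ (e * suc K)

  -- The remainder has exponent (m+1)(N+1), at least `N`, so it vanishes and `N` terms already
  -- represent q^(m+1)/(1 - q^(m+1)).
  geometric : ∀ m → (𝟙 ⊖ q^ suc m) ⊛ Σ< N (λ b → q^ (suc m * suc b)) ≈ q^ suc m
  geometric m = begin
    (𝟙 ⊖ q^ suc m) ⊛ s                          ≈⟨ ≗⇒≈ (λ n → ℤₚ.+-identityʳ (((𝟙 ⊖ q^ suc m) ⊛ s) n)) ⟨
    (𝟙 ⊖ q^ suc m) ⊛ s ⊕ 𝟘                      ≈⟨ +-congˡ {(𝟙 ⊖ q^ suc m) ⊛ s} (q^-≈0 (ℕₚ.≤-trans (ℕₚ.n≤1+n N) (ℕₚ.m≤n*m (suc N) (suc m)))) ⟨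
    (𝟙 ⊖ q^ suc m) ⊛ s ⊕ q^ (suc m * suc N)     ≈⟨ geometric-partial (suc m) N ⟩
    q^ suc m                                    ∎
    where s = Σ< N (λ b → q^ (suc m * suc b))

  -- The number of factors defining the infinite product varies with the coefficient; by stability,
  -- the same `N` factors serve for all coefficients below `N`.
  poch≈Π< : ∀ a (f : ℕ → Series) → (∀ m → 𝟙 ⊖ a ⊛ q^ (1 * m) ≗ f m) → ⦅ a ⦆∞ ≈ Π< N f
  poch≈Π< a f factor = ≈-trans
    (trunc λ n n<N → reflᶜ (sym (poch-stable a 1 n N n<N)))
    (partialPoch≈Π< N)
    where
    partialPoch≈Π< : ∀ n → partialPoch a 1 n ≈ Π< n f
    partialPoch≈Π< zero    = ≈-refl
    partialPoch≈Π< (suc n) = ⊛-cong-≈ (partialPoch≈Π< n) (≗⇒≈ (factor n))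

  ⦅q⦆∞≈ : ⦅ q^ 1 ⦆∞ ≈ Π< N (λ m → 𝟙 ⊖ q^ suc m)
  ⦅q⦆∞≈ = poch≈Π< (q^ 1) _ λ m n → cong (ℤ._-_ (𝟙 n)) (q⊛q^ m n)

  ⦅-q⦆∞≈ : ⦅ ⊝ q^ 1 ⦆∞ ≈ Π< N (λ m → 𝟙 ⊕ q^ suc m)
  ⦅-q⦆∞≈ = poch≈Π< (⊝ q^ 1) _ λ m n → cong (ℤ._+_ (𝟙 n)) (-[-q⊛q^] m n)

-- The quotient (-q)_∞/(q)_∞ modulo 4.

module Mod4 (N : ℕ) where

  open Truncated (+ 4) N
  open import Relation.Binary.Reasoning.Setoid setoid

  four≈0 : 𝟙 ⊕ 𝟙 ⊕ 𝟙 ⊕ 𝟙 ≈ 𝟘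
  four≈0 = trunc λ where
    zero    _ → mk Signed.∣-refl
    (suc _) _ → reflᶜ refl

  -- The squares from 1 to N^2; modulo q^N, `𝟙 ⊕ (θ ⊕ θ)` is the theta series, the sum of q^(a^2)
  -- over all integers a.
  θ : Series
  θ = Σ< N (λ a → q^ (suc a * suc a))

  ⦅-q⦆∞≈[1+2θ]⦅q⦆∞ : ⦅ ⊝ q^ 1 ⦆∞ ≈ (𝟙 ⊕ (θ ⊕ θ)) ⊛ ⦅ q^ 1 ⦆∞
  ⦅-q⦆∞≈[1+2θ]⦅q⦆∞ = begin
    ⦅ ⊝ q^ 1 ⦆∞
      ≈⟨ ⦅-q⦆∞≈ ⟩
    Π< N (λ m → 𝟙 ⊕ q^ suc m)
      ≈⟨ Π<[1+x]≈[1+2Σ<g]*Π<[1-x] four≈0 (λ m → 1-q^e+q^e (suc m)) geometric N ⟩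
    (𝟙 ⊕ (Λ ⊕ Λ)) ⊛ Π< N (λ m → 𝟙 ⊖ q^ suc m)
      -- `Λ` sums q^(ab) over 1 ≤ a, b ≤ N, and its diagonal is `θ`.
      ≈⟨ ⊛-cong-≈ (+-congˡ {𝟙} (symmetric-sum-doubled four≈0 M M-sym N)) (≈-sym ⦅q⦆∞≈) ⟩
    (𝟙 ⊕ (θ ⊕ θ)) ⊛ ⦅ q^ 1 ⦆∞ ∎
    where
    M : ℕ → ℕ → Series
    M a b = q^ (suc a * suc b)
    M-sym : ∀ a b → M a b ≈ M b a
    M-sym a b = ≗⇒≈ λ n → cong (λ e → (q^ e) n) (ℕₚ.*-comm (suc a) (suc b))
    Λ = Σ< N (λ a → Σ< N (M a))

  -- The factor (q)_∞ produced by the previous congruence cancels against its reciprocal. The factor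
  -- `B` is arbitrary here; `k` and `i` enter only through it.
  ⦅-q⦆∞B⊘⦅q⦆∞≈[1+2θ]B : ∀ B → (⦅ ⊝ q^ 1 ⦆∞ ⊛ B) ⊘ ⦅ q^ 1 ⦆∞ ≈ (𝟙 ⊕ (θ ⊕ θ)) ⊛ B
  ⦅-q⦆∞B⊘⦅q⦆∞≈[1+2θ]B B = begin
    ⦅ ⊝ q^ 1 ⦆∞ ⊛ B ⊛ r          ≈⟨ *-congʳ {r} (*-congʳ {B} ⦅-q⦆∞≈[1+2θ]⦅q⦆∞) ⟩
    φ ⊛ ⦅ q^ 1 ⦆∞ ⊛ B ⊛ r        ≈⟨ solve 4 (λ p c b r → p :* c :* b :* r := p :* b :* (c :* r)) ≈-refl φ ⦅ q^ 1 ⦆∞ B r ⟩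
    φ ⊛ B ⊛ (⦅ q^ 1 ⦆∞ ⊛ r)      ≈⟨ *-congˡ {φ ⊛ B} (≗⇒≈ (⊛-recip ⦅ q^ 1 ⦆∞ poch-q-0)) ⟩
    φ ⊛ B ⊛ 𝟙                    ≈⟨ ≗⇒≈ (⊛-identityʳ (φ ⊛ B)) ⟩
    φ ⊛ B                        ∎
    where
    open SemiringSolver ring
    φ = 𝟙 ⊕ (θ ⊕ θ)
    r = recip ⦅ q^ 1 ⦆∞

-- Exponents modulo 3 and the vanishing coefficient.

3∤1+n² : ∀ n → ¬ 3 ∣ suc (n * n)
3∤1+n² 0 = from-no (3 ∣? 1)
3∤1+n² 1 = from-no (3 ∣? 2)
3∤1+n² 2 = from-no (3 ∣? 5)
-- Replacing n by n + 3 changes 1 + n^2 by the multiple 3(2n + 3) of 3.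
3∤1+n² (suc (suc (suc n))) 3∣ =
  3∤1+n² n (∣m+n∣m⇒∣n (subst (3 ∣_) (identity n) 3∣) (m∣m*n (2 * n + 3)))
  where
  identity : ∀ n → suc ((3 + n) * (3 + n)) ≡ 3 * (2 * n + 3) + suc (n * n)
  identity = ℕ-Solver.solve-∀

mainTheorem3 : (k i : ℕ) → 1 ≤ i → 2 * i ≤ k → 3 ∣ k → 3 ∣ i →
    (n : ℕ) → (+ 4) ℤ.∣ S k i (3 * n + 2)
mainTheorem3 k i _ 2i≤k 3∣k 3∣i n =
  -- `S k i` agrees modulo 4 with the series (1 + 2θ)B, whose coefficient at `n₀` is exactly 0.
  Signed.∣⇒∣ᵤ (subst ((+ 4) Signed.∣_) S-0≡S (difference (coeff (⦅-q⦆∞B⊘⦅q⦆∞≈[1+2θ]B B) n₀ ℕₚ.≤-refl)))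
  where
  n₀ = 3 * n + 2
  -- Truncation at q^(n₀+1) is the coarsest that retains coefficient `n₀`.
  open Mod4 (suc n₀)
  open Truncated (+ 4) (suc n₀)
  open _≡ᶜ_

  B : Series
  B = ⦅ q^ i ⨾q^ k ⦆∞ ⊛ ⦅ q^ (k ∸ i) ⨾q^ k ⦆∞ ⊛ ⦅ q^ k ⨾q^ k ⦆∞

  3∣k∸i : 3 ∣ k ∸ i
  -- The bound 2i ≤ k gives i ≤ k, so the truncated difference satisfies i + (k ∸ i) = k.
  3∣k∸i = ∣m+n∣m⇒∣n
    (subst (3 ∣_) (sym (ℕₚ.m+[n∸m]≡n (ℕₚ.≤-trans (ℕₚ.m≤m+n i _) 2i≤k))) 3∣k) 3∣i

  B-supported : Supported (3 ∣_) B
  B-supported = ⊛-∣-supported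
    (⊛-∣-supported (poch-∣-supported 3∣i 3∣k) (poch-∣-supported 3∣k∸i 3∣k))
    (poch-∣-supported 3∣k 3∣k)

  -- The exponents not congruent to 2 modulo 3, a class stable under adding multiples of 3.
  P : Pred ℕ 0ℓ
  P m = ¬ 3 ∣ suc m

  P-+ : ∀ {a b} → P a → 3 ∣ b → P (a + b)
  P-+ {a} {b} Pa 3∣b 3∣1+a+b =
    Pa (∣m+n∣m⇒∣n (subst (3 ∣_) (ℕₚ.+-comm (suc a) b) 3∣1+a+b) 3∣b)

  θ-supported : Supported P θ
  θ-supported = Σ<-supported (λ a → q^-supported (3∤1+n² (suc a))) (suc n₀)

  φB-supported : Supported P ((𝟙 ⊕ (θ ⊕ θ)) ⊛ B)
  φB-supported = ⊛-supported (λ m → ¬? (3 ∣? suc m)) (3 ∣?_) P-+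
    -- The exponents of 1 + 2θ are 0 and squares, none congruent to 2 modulo 3, while those of `B`
    -- are multiples of 3.
    (⊕-supported (𝟙-supported (from-no (3 ∣? 1))) (⊕-supported θ-supported θ-supported))
    B-supported

  3∣1+n₀ : 3 ∣ suc n₀
  3∣1+n₀ = subst (3 ∣_) (identity n) (m∣m*n (n + 1))
    where
    identity : ∀ n → 3 * (n + 1) ≡ suc (3 * n + 2)
    identity = ℕ-Solver.solve-∀

  S-0≡S : S k i n₀ ℤ.- ((𝟙 ⊕ (θ ⊕ θ)) ⊛ B) n₀ ≡ S k i n₀
  S-0≡S = trans (cong (ℤ._-_ (S k i n₀)) (φB-supported n₀ λ Pn₀ → Pn₀ 3∣1+n₀))
                (ℤₚ.+-identityʳ (S k i n₀))
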